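{- A connected graph $G$ with minimum degree at least $2$ is single conflict $2$-colorable if and only if $G$ consists of two or three internally disjoint paths connecting two distinct vertices of $G$.
   Context: Graphs are finite and simple. A local $k$-partition of a graph $G$ is a collection $\{c_v\}_{v\in V(G)}$ of maps $c_v : E(v)\to\{1,\dots,k\}$, where $E(v)$ is the set of edges incident with $v$. $G$ is conflict $\{c_v\}$-colorable if there is a map $\varphi : V(G)\to\{1,\dots,k\}$ such that no edge $e=xy$ satisfies both $\varphi(x)=c_x(e)$ and $\varphi(y)=c_y(e)$. $G$ is single conflict $k$-colorable if it is conflict $\{c_v\}$-colorable for every local $k$-partition $\{c_v\}$. "$G$ consists of two or three internally disjoint paths connecting two distinct vertices" means that there are distinct vertices $a,b$ of $G$ such that $G$ is the union of two or three distinct $a$–$b$ paths, which pairwise share only the vertices $a$ and $b$. -}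

module Defs where

open import Data.Bool using (Bool; false; T)
open import Data.Fin using (Fin)
open import Data.Fin.Subset using (Subset; ∣_∣)
open import Data.List using (List; []; _∷_)
open import Data.List.Membership.Propositional using (_∈_)
open import Data.List.Relation.Unary.Unique.Propositional using (Unique)
open import Data.Nat using (ℕ; _≤_)
open import Data.Product using (Σ-syntax; ∃-syntax; _×_; _,_)
open import Data.Sum using (_⊎_)
open import Data.Vec using (tabulate)
open import Relation.Binary.Construct.Closure.ReflexiveTransitive using (Star; ε; _◅_)
open import Relation.Binary.PropositionalEquality using (_≡_; _≢_; subst)
open import Relation.Nullary using (¬_)

-- Adjacency is Boolean so that it is decidable and so that `T (adj u v)` has
-- at most one inhabitant: there are no parallel edges.
record Graph (n : ℕ) : Set where
  field
    adj       : Fin n → Fin n → Bool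
    symmetric : ∀ u v → adj u v ≡ adj v u
    loopless  : ∀ v → adj v v ≡ false

  V : Set
  V = Fin n

  Adj : V → V → Set
  Adj u v = T (adj u v)

  Adj-sym : ∀ {u v} → Adj u v → Adj v u
  Adj-sym {u} {v} = subst T (symmetric u v)

  -- E(v): since the graph is simple, an edge incident with v is given by its
  -- other end.  The edge xy is thus (y , e) in E(x) and (x , Adj-sym e) in E(y).
  EdgeAt : V → Set
  EdgeAt v = Σ[ u ∈ V ] Adj v u

  neighbours : V → Subset n
  neighbours v = tabulate (adj v)

  degree : V → ℕ
  degree v = ∣ neighbours v ∣

open Graph public

Walk : ∀ {n} (G : Graph n) → V G → V G → Set
Walk G = Star (Adj G)

walkVertices : ∀ {n} (G : Graph n) {u v} → Walk G u v → List (V G)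
walkVertices G {u} ε       = u ∷ []
walkVertices G {u} (_ ◅ w) = u ∷ walkVertices G w

walkSteps : ∀ {n} (G : Graph n) {u v} → Walk G u v → List (V G × V G)
walkSteps G ε = []
walkSteps G {u} (_◅_ {j = x} _ w) = (u , x) ∷ walkSteps G w

record Path {n} (G : Graph n) (u v : V G) : Set where
  field
    walk   : Walk G u v
    simple : Unique (walkVertices G walk)

  vertices : List (V G)
  vertices = walkVertices G walk

  steps : List (V G × V G)
  steps = walkSteps G walk

open Path public

infix 4 _∈ᵛ_ _~_∈ᵉ_

_∈ᵛ_ : ∀ {n} {G : Graph n} {a b} → V G → Path G a b → Set
x ∈ᵛ P = x ∈ vertices P

-- Steps are directed along the path, edges are not.
_~_∈ᵉ_ : ∀ {n} {G : Graph n} {a b} → V G → V G → Path G a b → Set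
x ~ y ∈ᵉ P = (x , y) ∈ steps P ⊎ (y , x) ∈ steps P

-- The factor `V G` excludes the null graph, which is not counted as connected.
Connected : ∀ {n} → Graph n → Set
Connected G = V G × (∀ u v → Path G u v)

MinDegreeAtLeast : ∀ {n} → ℕ → Graph n → Set
MinDegreeAtLeast d G = ∀ v → d ≤ degree G v

LocalPartition : ∀ {n} → ℕ → Graph n → Set
LocalPartition k G = (v : V G) → EdgeAt G v → Fin k

ConflictColorable : ∀ {n k} (G : Graph n) → LocalPartition k G → Set
ConflictColorable {k = k} G c =
  Σ[ φ ∈ (V G → Fin k) ]
    (∀ x y (e : Adj G x y) →
      ¬ (φ x ≡ c x (y , e) × φ y ≡ c y (x , Adj-sym G e)))

SingleConflictColorable : ∀ {n} → ℕ → Graph n → Set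
SingleConflictColorable k G = (c : LocalPartition k G) → ConflictColorable G c

-- Two a–b paths of a simple graph are equal as subgraphs exactly when their
-- vertex sequences agree, so `distinct` compares the latter.
record IsUnionOfDisjointPaths {n} (G : Graph n) (m : ℕ) (a b : V G)
                              (P : Fin m → Path G a b) : Set where
  field
    distinct           : ∀ i j → i ≢ j → vertices (P i) ≢ vertices (P j)
    internallyDisjoint : ∀ i j → i ≢ j → ∀ x →
                         x ∈ᵛ P i → x ∈ᵛ P j → x ≡ a ⊎ x ≡ b
    coversVertices     : ∀ x → ∃[ i ] x ∈ᵛ P i
    coversEdges        : ∀ x y → Adj G x y → ∃[ i ] x ~ y ∈ᵉ P i

ConsistsOfDisjointPaths : ∀ {n} → ℕ → Graph n → Set
ConsistsOfDisjointPaths m G =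
  ∃[ a ] ∃[ b ] (a ≢ b ×
    Σ[ P ∈ (Fin m → Path G a b) ] IsUnionOfDisjointPaths G m a b P)

{-# OPTIONS --safe #-}
module Submission where

-- Necessity.  A cycle can be oriented as a cycle of implications "x has colour p
-- ⇒ y has colour p", so that any solution is constant on it.  A walk leaving a set K
-- on which the colouring is constant, and returning to K or to itself (a lasso),
-- can exclude the value p of that constant: let p propagate along it and forbid
-- p on both ends of its last edge.  Two edge-disjoint lassos on such a K therefore
-- exclude both values, where K is a single vertex or a cycle.  Now G contains a
-- cycle; an edge leaving it extends, as degrees are at least 2, to a lasso, which
-- must be a path between two distinct vertices of the cycle (otherwise the cycle
-- itself is a second lasso on the vertex left), and an edge leaving the resulting
-- theta graph extends to a lasso with both attachments on a common cycle, whose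
-- complementary path is a second lasso.
--
-- Sufficiency.  Given the colours of a and b, colouring an a–b path fails for at
-- most one of the four pairs of colours, so three paths leave some pair possible.

open import Data.Bool using (T)
open import Data.Bool.Properties using (T-irrelevant; T?)
open import Data.Empty using (⊥; ⊥-elim)
open import Data.Fin using (Fin; zero; suc; opposite; combine; remQuot)
open import Data.Fin.Properties using (_≟_; any?; all?; injective⇒≤; combine-remQuot)
open import Data.Fin.Subset using (⁅_⁆)
import Data.Fin.Subset as Subset
open import Data.Fin.Subset.Properties using (p⊆q⇒∣p∣≤∣q∣; ∣⁅x⁆∣≡1; x∈⁅x⁆)
open import Data.List using (List; []; _∷_; _++_; [_]; map; length; lookup; zip; drop)
open import Data.List.Properties using (map-++)
open import Data.List.Membership.Propositional using (_∈_)
open import Data.List.Membership.Propositional.Properties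
  using (∈-++⁺ˡ; ∈-++⁺ʳ; ∈-++⁻; ∈-map⁺; ∈-map⁻; ∈-lookup)
import Data.List.Membership.Setoid as SetoidMembership
import Data.List.Membership.Setoid.Properties as SetoidMembershipₚ
import Data.List.Relation.Binary.Disjoint.Setoid as SetoidDisjoint
open import Data.List.Relation.Binary.Permutation.Propositional
  using (_↭_; ↭-refl; ↭-sym; ↭-trans; ↭-reflexive; prep; ↭⇒↭ₛ)
import Data.List.Relation.Binary.Permutation.Propositional.Properties as ↭
import Data.List.Relation.Binary.Permutation.Setoid.Properties as ↭ₛ
open import Data.List.Relation.Unary.All using (All; []; _∷_)
import Data.List.Relation.Unary.All as All
import Data.List.Relation.Unary.All.Properties as All
open import Data.List.Relation.Unary.AllPairs using ([]; _∷_)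
open import Data.List.Relation.Unary.Any using (here; there)
import Data.List.Relation.Unary.Any as Any
import Data.List.Relation.Unary.Any.Properties as Any
import Data.List.Relation.Unary.Unique.Setoid as SetoidUnique
import Data.List.Relation.Unary.Unique.Setoid.Properties as SetoidUniqueₚ
open import Data.List.Relation.Unary.Unique.Propositional using (Unique)
import Data.List.Relation.Unary.Unique.Propositional.Properties as Unique
open import Data.Nat using (ℕ; zero; suc; _+_; _≤_; _<_; z≤n; s≤s)
open import Data.Nat.Properties using (≤-trans; ≤-reflexive; <⇒≱; +-suc; m≤m+n)
open import Data.Product using (Σ-syntax; ∃; ∃-syntax; _×_; _,_; proj₁; proj₂)
open import Data.Sum using (_⊎_; inj₁; inj₂; [_,_]′)
import Data.Sum as Sum
open import Data.Vec.Properties using ([]=⇒lookup; lookup∘tabulate)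
open import Function using (_∘_; id)
open import Function.Bundles using (_⇔_; mk⇔; Equivalence)
open import Level using (0ℓ)
open import Relation.Binary.Bundles using (Setoid)
open import Relation.Binary.Construct.Closure.ReflexiveTransitive using (ε; _◅_; _◅◅_)
open import Relation.Binary.Construct.Closure.ReflexiveTransitive.Properties using (◅◅-assoc)
open import Relation.Binary.PropositionalEquality
  using (_≡_; _≢_; refl; sym; trans; cong; cong₂; subst; setoid)
open import Relation.Nullary using (¬_; Dec; yes; no; contradiction)
open import Relation.Nullary.Decidable using (_×-dec_; _⊎-dec_; ¬?; from-yes; decidable-stable)
open import Relation.Unary using (Pred; Decidable)
open import Defs

-- Repetition-free lists and undirected edges

module _ {c ℓ} (S : Setoid c ℓ) where
  open SetoidMembership S using () renaming (_∈_ to _∈ₛ_)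
  open SetoidUnique S using () renaming (Unique to Uniqueₛ)
  open SetoidDisjoint S using (Disjoint)
  open Setoid S using (_≈_) renaming (sym to ≈-sym; trans to ≈-trans)

  -- Stated over a setoid because it is applied both to vertices under `≡` and to edges under `≈ᵉ`.
  Unique-++⁻ : ∀ xs {ys} → Uniqueₛ (xs ++ ys) → Uniqueₛ xs × Uniqueₛ ys × Disjoint xs ys
  Unique-++⁻ []       u        = [] , u , λ { (() , _) }
  Unique-++⁻ (x ∷ xs) (px ∷ u) with Unique-++⁻ xs u
  ... | uxs , uys , d = All.++⁻ˡ xs px ∷ uxs , uys , λ
    { (here v≈x , v∈ys)  → All.All¬⇒¬Any (All.++⁻ʳ xs px) (Any.map (≈-trans (≈-sym v≈x)) v∈ys)
    ; (there v∈xs , v∈ys) → d (v∈xs , v∈ys) }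

  ∉⇒All≉ : ∀ {x xs} → ¬ (x ∈ₛ xs) → All (λ y → ¬ (x ≈ y)) xs
  ∉⇒All≉ = All.¬Any⇒All¬ _

module _ {A : Set} where

  infix 4 _≈ᵉ_

  -- Walk steps are directed; this compares the underlying edges. `Uniqueᴱ` of a list of steps thus
  -- says that no edge is traversed twice, in either direction.
  _≈ᵉ_ : A × A → A × A → Set
  (x , y) ≈ᵉ (u , v) = (x ≡ u × y ≡ v) ⊎ (x ≡ v × y ≡ u)

  edgeSetoid : Setoid 0ℓ 0ℓ
  edgeSetoid = record
    { Carrier       = A × A
    ; _≈_           = _≈ᵉ_
    ; isEquivalence = record
      { refl  = inj₁ (refl , refl)
      ; sym   = λ { (inj₁ (refl , refl)) → inj₁ (refl , refl)
                  ; (inj₂ (refl , refl)) → inj₂ (refl , refl) }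
      ; trans = λ { (inj₁ (refl , refl)) q → q
                  ; (inj₂ (refl , refl)) (inj₁ (refl , refl)) → inj₂ (refl , refl)
                  ; (inj₂ (refl , refl)) (inj₂ (refl , refl)) → inj₁ (refl , refl) }
      }
    }

  open SetoidMembership edgeSetoid public using () renaming (_∈_ to _∈ᴱ_)
  open SetoidUnique edgeSetoid public using () renaming (Unique to Uniqueᴱ)
  open SetoidDisjoint edgeSetoid public using () renaming (Disjoint to Disjointᴱ)
  open Setoid edgeSetoid public using () renaming (refl to ≈ᵉ-refl; sym to ≈ᵉ-sym; trans to ≈ᵉ-trans)

  ≈ᵉ-swap : ∀ {x y : A} → (y , x) ≈ᵉ (x , y)
  ≈ᵉ-swap = inj₂ (refl , refl)

  ∈ᴱ-resp-≈ : ∀ {xs} {s t : A × A} → s ≈ᵉ t → s ∈ᴱ xs → t ∈ᴱ xs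
  ∈ᴱ-resp-≈ = SetoidMembershipₚ.∈-resp-≈ edgeSetoid

  ∈⇒∈ᴱ : ∀ {s : A × A} {xs} → s ∈ xs → s ∈ᴱ xs
  ∈⇒∈ᴱ = Any.map λ { refl → ≈ᵉ-refl }

  ∈ᴱ⇒∈ : ∀ {x y : A} {xs} → (x , y) ∈ᴱ xs → (x , y) ∈ xs ⊎ (y , x) ∈ xs
  ∈ᴱ⇒∈ (here (inj₁ (refl , refl))) = inj₁ (here refl)
  ∈ᴱ⇒∈ (here (inj₂ (refl , refl))) = inj₂ (here refl)
  ∈ᴱ⇒∈ (there p)                   = Sum.map there there (∈ᴱ⇒∈ p)

  Disjointᴱ-sym : ∀ {xs ys : List (A × A)} → Disjointᴱ xs ys → Disjointᴱ ys xs
  Disjointᴱ-sym d (p , q) = d (q , p)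

  Disjointᴱ-++ : ∀ {xs ys zs : List (A × A)} →
                 Disjointᴱ xs ys → Disjointᴱ xs zs → Disjointᴱ xs (ys ++ zs)
  Disjointᴱ-++ {ys = ys} d d′ (p , q) = [ (λ q → d (p , q)) , (λ q → d′ (p , q)) ]′ (Any.++⁻ ys q)

  ++ᴱ⁺ : ∀ {xs ys : List (A × A)} → Uniqueᴱ xs → Uniqueᴱ ys → Disjointᴱ xs ys → Uniqueᴱ (xs ++ ys)
  ++ᴱ⁺ = SetoidUniqueₚ.++⁺ edgeSetoid

  Uniqueᴱ-resp-↭ : ∀ {xs ys : List (A × A)} → xs ↭ ys → Uniqueᴱ xs → Uniqueᴱ ys
  Uniqueᴱ-resp-↭ p = ↭ₛ.AllPairs-resp-↭ (setoid _) (λ x≉y → x≉y ∘ ≈ᵉ-sym)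
    ((λ { refl → id }) , λ { refl → id }) (↭⇒↭ₛ p)

  Unique-resp-↭ : ∀ {xs ys : List A} → xs ↭ ys → Unique xs → Unique ys
  Unique-resp-↭ p = ↭ₛ.Unique-resp-↭ (setoid _) (↭⇒↭ₛ p)

-- Pigeonhole principles and the two colours

lookup-injective : ∀ {A : Set} {xs : List A} → Unique xs → ∀ {i j} → lookup xs i ≡ lookup xs j → i ≡ j
lookup-injective (_ ∷ _)  {zero}  {zero}  _  = refl
lookup-injective (x∉ ∷ _) {zero}  {suc j} eq = contradiction eq (All.lookup x∉ (∈-lookup j))
lookup-injective (x∉ ∷ _) {suc i} {zero}  eq = contradiction (sym eq) (All.lookup x∉ (∈-lookup i))
lookup-injective (_ ∷ u)  {suc i} {suc j} eq = cong suc (lookup-injective u eq)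

-- If every value were hit, choosing preimages would inject `Fin k` into `Fin m`.
missed-value : ∀ {m k} → m < k → (f : Fin m → Fin k) → ∃[ y ] (∀ i → f i ≢ y)
missed-value {m} {k} m<k f with any? (λ y → all? (λ i → ¬? (f i ≟ y)))
... | yes found = found
... | no ¬found = contradiction (injective⇒≤ preimage-injective) (<⇒≱ m<k)
  where
  hit : ∀ y → ∃[ i ] f i ≡ y
  hit y with any? (λ i → f i ≟ y)
  ... | yes found = found
  ... | no ¬hit   = contradiction (y , λ i eq → ¬hit (i , eq)) ¬found

  preimage-injective : ∀ {x y} → proj₁ (hit x) ≡ proj₁ (hit y) → x ≡ y
  preimage-injective {x} {y} eq = trans (sym (proj₂ (hit x))) (trans (cong f eq) (proj₂ (hit y)))

-- For an ear attached to paths `i` and `j` of a theta graph: paths `i` and `j′` form a cycle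
-- containing both attachments, and `k` is the complementary path. Checked by exhaustion.
two-others : ∀ (i j : Fin 3) → ∃[ j′ ] ∃[ k ] (i ≢ j′ × i ≢ k × j′ ≢ k × (j ≡ i ⊎ j ≡ j′))
two-others = from-yes (all? {n = 3} λ i → all? {n = 3} λ j → any? {n = 3} λ j′ → any? {n = 3} λ k →
  ¬? (i ≟ j′) ×-dec ¬? (i ≟ k) ×-dec ¬? (j′ ≟ k) ×-dec ((j ≟ i) ⊎-dec (j ≟ j′)))

≢⇒≡opposite : ∀ {p q : Fin 2} → p ≢ q → p ≡ opposite q
≢⇒≡opposite {zero}     {zero}     p≢q = contradiction refl p≢q
≢⇒≡opposite {zero}     {suc zero} p≢q = refl
≢⇒≡opposite {suc zero} {zero}     p≢q = refl
≢⇒≡opposite {suc zero} {suc zero} p≢q = contradiction refl p≢q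

opposite-≢ : ∀ (p : Fin 2) → opposite p ≢ p
opposite-≢ zero       ()
opposite-≢ (suc zero) ()

module _ {n : ℕ} (G : Graph n) where

  private
    Vertex = V G

  Adj-irreflexive : ∀ {x y} → Adj G x y → x ≢ y
  Adj-irreflexive {x} e refl = subst T (loopless G x) e

  open import Data.List.Membership.DecPropositional (_≟_ {n}) using (_∈?_)

  _≈ᵉ?_ : ∀ (s t : Vertex × Vertex) → Dec (s ≈ᵉ t)
  (x , y) ≈ᵉ? (u , v) = ((x ≟ u) ×-dec (y ≟ v)) ⊎-dec ((x ≟ v) ×-dec (y ≟ u))

  _∈ᴱ?_ : ∀ (s : Vertex × Vertex) xs → Dec (s ∈ᴱ xs)
  s ∈ᴱ? xs = Any.any? (s ≈ᵉ?_) xs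

  -- Walks

  tailVertices : ∀ {u v} → Walk G u v → List Vertex
  tailVertices w = map proj₂ (walkSteps G w)

  walkVertices-tail : ∀ {u v} (w : Walk G u v) → walkVertices G w ≡ u ∷ tailVertices w
  walkVertices-tail ε       = refl
  walkVertices-tail (e ◅ w) = cong (_ ∷_) (walkVertices-tail w)

  walkSteps-◅◅ : ∀ {u v x} (p : Walk G u v) (q : Walk G v x) →
                 walkSteps G (p ◅◅ q) ≡ walkSteps G p ++ walkSteps G q
  walkSteps-◅◅ ε       q = refl
  walkSteps-◅◅ (e ◅ p) q = cong (_ ∷_) (walkSteps-◅◅ p q)

  tailVertices-◅◅ : ∀ {u v x} (p : Walk G u v) (q : Walk G v x) →
                    tailVertices (p ◅◅ q) ≡ tailVertices p ++ tailVertices q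
  tailVertices-◅◅ p q = trans (cong (map proj₂) (walkSteps-◅◅ p q)) (map-++ proj₂ (walkSteps G p) _)

  walkVertices-snoc : ∀ {u v x} (p : Walk G u v) (e : Adj G v x) →
                      walkVertices G (p ◅◅ (e ◅ ε)) ≡ walkVertices G p ++ [ x ]
  walkVertices-snoc ε       e = refl
  walkVertices-snoc (d ◅ p) e = cong (_ ∷_) (walkVertices-snoc p e)

  start∈ : ∀ {u v} (w : Walk G u v) → u ∈ walkVertices G w
  start∈ ε       = here refl
  start∈ (_ ◅ _) = here refl

  end∈ : ∀ {u v} (w : Walk G u v) → v ∈ walkVertices G w
  end∈ ε       = here refl
  end∈ (_ ◅ w) = there (end∈ w)

  ∈-tail⇒∈ : ∀ {u v x} (w : Walk G u v) → x ∈ tailVertices w → x ∈ walkVertices G w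
  ∈-tail⇒∈ w p = subst (_ ∈_) (sym (walkVertices-tail w)) (there p)

  ∈⇒∈-tail : ∀ {u v x} (w : Walk G u v) → x ∈ walkVertices G w → x ≡ u ⊎ x ∈ tailVertices w
  ∈⇒∈-tail w p with subst (_ ∈_) (walkVertices-tail w) p
  ... | here x≡u = inj₁ x≡u
  ... | there q  = inj₂ q

  end∈-tail : ∀ {u v} → u ≢ v → (w : Walk G u v) → v ∈ tailVertices w
  end∈-tail u≢v w = [ (λ v≡u → contradiction (sym v≡u) u≢v) , id ]′ (∈⇒∈-tail w (end∈ w))

  step-source∈ : ∀ {u v x y} (w : Walk G u v) → (x , y) ∈ walkSteps G w → x ∈ walkVertices G w
  step-source∈ (e ◅ w) (here refl) = here refl
  step-source∈ (e ◅ w) (there p)   = there (step-source∈ w p)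

  step-target∈ : ∀ {u v x y} (w : Walk G u v) → (x , y) ∈ walkSteps G w → y ∈ tailVertices w
  step-target∈ w p = ∈-map⁺ proj₂ p

  edge-ends∈ : ∀ {u v x y} (w : Walk G u v) → (x , y) ∈ᴱ walkSteps G w →
               x ∈ walkVertices G w × y ∈ walkVertices G w
  edge-ends∈ w p with ∈ᴱ⇒∈ p
  ... | inj₁ q = step-source∈ w q , ∈-tail⇒∈ w (step-target∈ w q)
  ... | inj₂ q = ∈-tail⇒∈ w (step-target∈ w q) , step-source∈ w q

  simple⇒Uniqueᴱ : ∀ {u v} (w : Walk G u v) → Unique (walkVertices G w) → Uniqueᴱ (walkSteps G w)
  simple⇒Uniqueᴱ ε       _         = []
  simple⇒Uniqueᴱ (e ◅ w) (u∉ ∷ uw) =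
    ∉⇒All≉ edgeSetoid (λ p → All.All¬⇒¬Any u∉ (proj₁ (edge-ends∈ w p))) ∷ simple⇒Uniqueᴱ w uw

  record Splitting {u v} (w : Walk G u v) (x : Vertex) : Set where
    constructor splitting
    field
      {front} : Walk G u x
      {back}  : Walk G x v
      joined  : w ≡ front ◅◅ back

  split : ∀ {u v x} (w : Walk G u v) → x ∈ walkVertices G w → Splitting w x
  split ε       (here refl) = splitting {front = ε} {back = ε} refl
  split (e ◅ w) (here refl) = splitting {front = ε} refl
  split (e ◅ w) (there p) with split w p
  ... | splitting {front} refl = splitting {front = e ◅ front} refl

  -- Cuts at an occurrence after the first vertex, so that `front` is nonempty even if `x` is also
  -- the start, as happens on closed walks.
  split-tail : ∀ {u v x} (w : Walk G u v) → x ∈ tailVertices w →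
               Σ[ s ∈ Splitting w x ] x ∈ tailVertices (Splitting.front s)
  split-tail (e ◅ w) (here refl) = splitting {front = e ◅ ε} refl , here refl
  split-tail (e ◅ w) (there p) with split-tail w p
  ... | splitting {front} refl , q = splitting {front = e ◅ front} refl , there q

  -- The hypothesis `v ∈ tailVertices w` is how nonemptiness of a walk is expressed, here and below.
  unsnoc : ∀ {u v} → (w : Walk G u v) → v ∈ tailVertices w →
           ∃[ z ] Σ[ p ∈ Walk G u z ] Σ[ e ∈ Adj G z v ] w ≡ p ◅◅ (e ◅ ε)
  unsnoc (e ◅ ε)          _ = _ , ε , e , refl
  unsnoc (e ◅ w@(d ◅ w′)) _ with unsnoc w (last∈ d w′)
    where
    last∈ : ∀ {x y z} (d : Adj G x y) (w : Walk G y z) → z ∈ tailVertices (d ◅ w)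
    last∈ d w = [ here , there ]′ (∈⇒∈-tail w (end∈ w))
  ... | _ , p , e′ , eq = _ , e ◅ p , e′ , cong (e ◅_) eq

  reverseWalk : ∀ {u v} → Walk G u v → Walk G v u
  reverseWalk ε       = ε
  reverseWalk (e ◅ w) = reverseWalk w ◅◅ (Adj-sym G e ◅ ε)

  walkVertices-reverse : ∀ {u v} (w : Walk G u v) →
                         walkVertices G (reverseWalk w) ↭ walkVertices G w
  walkVertices-reverse ε           = ↭-refl
  walkVertices-reverse {u} (e ◅ w) =
    ↭-trans (↭-reflexive (walkVertices-snoc (reverseWalk w) _))
      (↭-trans (↭.++-comm (walkVertices G (reverseWalk w)) [ u ]) (prep u (walkVertices-reverse w)))

  ∈ᴱ-reverse⁻ : ∀ {u v s} (w : Walk G u v) →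
                s ∈ᴱ walkSteps G (reverseWalk w) → s ∈ᴱ walkSteps G w
  ∈ᴱ-reverse⁻ (e ◅ w) p
    with Any.++⁻ (walkSteps G (reverseWalk w)) (subst (_ ∈ᴱ_) (walkSteps-◅◅ (reverseWalk w) _) p)
  ... | inj₁ q        = there (∈ᴱ-reverse⁻ w q)
  ... | inj₂ (here q) = here (≈ᵉ-trans q ≈ᵉ-swap)

  ∈ᴱ-reverse⁺ : ∀ {u v s} (w : Walk G u v) →
                s ∈ᴱ walkSteps G w → s ∈ᴱ walkSteps G (reverseWalk w)
  ∈ᴱ-reverse⁺ (e ◅ w) p = subst (_ ∈ᴱ_) (sym (walkSteps-◅◅ (reverseWalk w) _)) (lemma p)
    where
    lemma : ∀ {s} → s ∈ᴱ _ ∷ walkSteps G w → s ∈ᴱ walkSteps G (reverseWalk w) ++ _ ∷ []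
    lemma (here q)  = Any.++⁺ʳ (walkSteps G (reverseWalk w)) (here (≈ᵉ-trans q ≈ᵉ-swap))
    lemma (there q) = Any.++⁺ˡ (∈ᴱ-reverse⁺ w q)

  -- Clauses

  -- ((x , y) , (p , q)) forbids φ x ≡ p together with φ y ≡ q.
  Clause : Set
  Clause = (Vertex × Vertex) × (Fin 2 × Fin 2)

  edges : List Clause → List (Vertex × Vertex)
  edges = map proj₁

  Satisfies : (Vertex → Fin 2) → List Clause → Set
  Satisfies φ L = ∀ {x y p q} → ((x , y) , (p , q)) ∈ L → Adj G x y → ¬ (φ x ≡ p × φ y ≡ q)

  Satisfies-++ˡ : ∀ {φ} L {M} → Satisfies φ (L ++ M) → Satisfies φ L
  Satisfies-++ˡ L sat = sat ∘ ∈-++⁺ˡ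

  Satisfies-++ʳ : ∀ {φ} L {M} → Satisfies φ (L ++ M) → Satisfies φ M
  Satisfies-++ʳ L sat = sat ∘ ∈-++⁺ʳ L

  -- Turns clauses into a local partition: the colour given at `x` to the edge `xy`, from the first
  -- clause on that edge in either orientation. Edges without a clause get the arbitrary colour
  -- `zero` at both ends.
  colourAt : List Clause → Vertex → Vertex → Fin 2
  colourAt []                          x y = zero
  colourAt (((u , v) , (p , q)) ∷ L) x y with (x ≟ u) ×-dec (y ≟ v) | (x ≟ v) ×-dec (y ≟ u)
  ... | yes _ | _     = p
  ... | no _  | yes _ = q
  ... | no _  | no _  = colourAt L x y

  -- As no edge repeats, no other clause can match first. The condition `x ≢ y` keeps the two
  -- orientations of the edge apart.
  colourAt-∈ : ∀ {L x y p q} → Uniqueᴱ (edges L) → x ≢ y → ((x , y) , (p , q)) ∈ L →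
               colourAt L x y ≡ p × colourAt L y x ≡ q
  colourAt-∈ {x = x} {y} _ x≢y (here refl)
    with (x ≟ x) ×-dec (y ≟ y) | (y ≟ x) ×-dec (x ≟ y) | (y ≟ y) ×-dec (x ≟ x)
  ... | no ¬r | _     | _     = contradiction (refl , refl) ¬r
  ... | yes _ | yes r | _     = contradiction (proj₂ r) x≢y
  ... | yes _ | no _  | no ¬r = contradiction (refl , refl) ¬r
  ... | yes _ | no _  | yes _ = refl , refl
  colourAt-∈ {((u , v) , _) ∷ L} {x} {y} (px ∷ uL) x≢y (there m)
    with All.lookup px (∈-map⁺ proj₁ m)
       | (x ≟ u) ×-dec (y ≟ v) | (x ≟ v) ×-dec (y ≟ u)
       | (y ≟ u) ×-dec (x ≟ v) | (y ≟ v) ×-dec (x ≟ u)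
  ... | ≉ | yes (refl , refl) | _ | _ | _ = contradiction ≈ᵉ-refl ≉
  ... | ≉ | _ | yes (refl , refl) | _ | _ = contradiction ≈ᵉ-swap ≉
  ... | ≉ | _ | _ | yes (refl , refl) | _ = contradiction ≈ᵉ-swap ≉
  ... | ≉ | _ | _ | _ | yes (refl , refl) = contradiction ≈ᵉ-refl ≉
  ... | _ | no _ | no _ | no _ | no _     = colourAt-∈ uL x≢y m

  -- A local partition forbids one pair of colours on each edge, so clauses on distinct edges can be
  -- imposed simultaneously.
  satisfiable : SingleConflictColorable 2 G → ∀ L → Uniqueᴱ (edges L) → ∃[ φ ] Satisfies φ L
  satisfiable scc L uL with scc (λ x (y , _) → colourAt L x y)
  ... | φ , ok = φ , λ m e (φx≡p , φy≡q) →
    let cx , cy = colourAt-∈ uL (Adj-irreflexive e) m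
    in ok _ _ e (trans φx≡p (sym cx) , trans φy≡q (sym cy))

  -- Colour p propagates from each vertex of the walk to the next one.
  chain : Fin 2 → ∀ {u v} → Walk G u v → List Clause
  chain p w = map (_, (p , opposite p)) (walkSteps G w)

  edges-chain : ∀ p {u v} (w : Walk G u v) → edges (chain p w) ≡ walkSteps G w
  edges-chain p ε       = refl
  edges-chain p (e ◅ w) = cong (_ ∷_) (edges-chain p w)

  private
    propagate : ∀ {φ p u x v} (e : Adj G u x) (w : Walk G x v) → Satisfies φ (chain p (e ◅ w)) →
                φ u ≡ p → φ x ≡ p
    propagate {φ} {p} {x = x} e w sat φu with φ x ≟ p
    ... | yes φx≡p = φx≡p
    ... | no φx≢p  = contradiction (φu , ≢⇒≡opposite φx≢p) (sat (here refl) e)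

  chain-forward : ∀ {φ p u v} (w : Walk G u v) → Satisfies φ (chain p w) → φ u ≡ p →
                  ∀ {x} → x ∈ walkVertices G w → φ x ≡ p
  chain-forward ε       sat φu (here refl) = φu
  chain-forward (e ◅ w) sat φu (here refl) = φu
  chain-forward (e ◅ w) sat φu (there x∈)  =
    chain-forward w (sat ∘ there) (propagate e w sat φu) x∈

  chain-to-end : ∀ {φ p u v} (w : Walk G u v) → Satisfies φ (chain p w) →
                 ∀ {x} → x ∈ walkVertices G w → φ x ≡ p → φ v ≡ p
  chain-to-end ε       sat (here refl) φx = φx
  chain-to-end (e ◅ w) sat (here refl) φx = chain-forward (e ◅ w) sat φx (end∈ (e ◅ w))
  chain-to-end (e ◅ w) sat (there x∈)  φx = chain-to-end w (sat ∘ there) x∈ φx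

  -- If `a` has colour `zero`, this spreads along `P` to `b`; a vertex of `Q` of the other colour
  -- would spread that colour along `Q` to `b`, a contradiction. The other case exchanges `P` and
  -- `Q`.
  chains-constant : ∀ {φ a b} (P Q : Walk G a b) →
                    Satisfies φ (chain zero P) → Satisfies φ (chain (suc zero) Q) →
                    ∀ {x} → x ∈ walkVertices G P ⊎ x ∈ walkVertices G Q → φ x ≡ φ a
  chains-constant {φ} {a} P Q satP satQ = go (φ a) refl
    where
    back : ∀ p {b} (R S : Walk G a b) → Satisfies φ (chain p R) →
           Satisfies φ (chain (opposite p) S) → φ a ≡ p →
           ∀ {x} → x ∈ walkVertices G S → φ x ≡ φ a
    back p R S satR satS φa {x} x∈ with φ x ≟ p
    ... | yes φx = trans φx (sym φa)
    ... | no φx  = contradiction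
      (trans (sym (chain-to-end S satS x∈ (≢⇒≡opposite φx))) (chain-forward R satR φa (end∈ R)))
      (opposite-≢ p)

    go : ∀ p → φ a ≡ p → ∀ {x} → x ∈ walkVertices G P ⊎ x ∈ walkVertices G Q → φ x ≡ φ a
    go zero       φa (inj₁ x∈) = trans (chain-forward P satP φa x∈) (sym φa)
    go zero       φa (inj₂ x∈) = back zero P Q satP satQ φa x∈
    go (suc zero) φa (inj₁ x∈) = back (suc zero) Q P satQ satP φa x∈
    go (suc zero) φa (inj₂ x∈) = trans (chain-forward Q satQ φa x∈) (sym φa)

  -- Lassos

  -- Returning to `v` falls under `K y`, since `K v` holds; the second alternative of `closes`
  -- therefore needs only the tail of the shaft.
  record Lasso (K : Pred Vertex 0ℓ) (v : Vertex) : Set where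
    field
      start  : K v
      {z y}  : Vertex
      shaft   : Walk G v z
      last   : Adj G z y
      closes : K y ⊎ y ∈ tailVertices shaft

    trail : Walk G v y
    trail = shaft ◅◅ (last ◅ ε)

    refutation : Fin 2 → List Clause
    refutation p = chain p shaft ++ [ (z , y) , (p , p) ]

    edges-refutation : ∀ p → edges (refutation p) ≡ walkSteps G trail
    edges-refutation p = trans (map-++ proj₁ (chain p shaft) _)
      (trans (cong (_++ _) (edges-chain p shaft)) (sym (walkSteps-◅◅ shaft _)))

    refutes : ∀ {φ} p → Satisfies φ (refutation p) → (∀ {x} → K x → φ x ≡ p) → ⊥
    refutes {φ} p sat φK =
      Satisfies-++ʳ {φ} (chain p shaft) sat (here refl) last (along (end∈ shaft) , end closes)
      where
      along : ∀ {x} → x ∈ walkVertices G shaft → φ x ≡ p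
      along = chain-forward shaft (Satisfies-++ˡ {φ} (chain p shaft) sat) (φK start)

      end : K y ⊎ y ∈ tailVertices shaft → φ y ≡ p
      end (inj₁ Ky) = φK Ky
      end (inj₂ y∈) = along (∈-tail⇒∈ shaft y∈)

  open Lasso

  -- Changes the base set but keeps the trail definitionally, so facts about its edges carry over.
  reLasso : ∀ {K K′ v} (l : Lasso K v) → K′ v → K′ (y l) ⊎ y l ∈ tailVertices (shaft l) → Lasso K′ v
  reLasso l K′v closes′ = record { start = K′v ; shaft = shaft l ; last = last l ; closes = closes′ }

  walkLasso : ∀ {K : Pred Vertex 0ℓ} {u v} (w : Walk G u v) → v ∈ tailVertices w → K u → K v →
              Σ[ l ∈ Lasso K u ] walkSteps G (trail l) ≡ walkSteps G w
  walkLasso w v∈ Ku Kv with unsnoc w v∈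
  ... | _ , p , e , refl =
    record { start = Ku ; shaft = p ; last = e ; closes = inj₁ Kv } , refl

  -- The common colour on `K` is excluded by `l` if it is `zero` and by `l′` otherwise. The clauses
  -- `L` that enforce constancy are chains around a cycle, or `[]` when `K` is a single vertex.
  two-lassos : SingleConflictColorable 2 G → ∀ {K : Pred Vertex 0ℓ} L →
               (∀ {φ} → Satisfies φ L → ∀ {x y} → K x → K y → φ x ≡ φ y) →
               ∀ {v v′} (l : Lasso K v) (l′ : Lasso K v′) →
               Uniqueᴱ (edges L ++ walkSteps G (trail l) ++ walkSteps G (trail l′)) → ⊥
  two-lassos scc {K} L constant {v} l l′ u
    with satisfiable scc (L ++ refutation l zero ++ refutation l′ (suc zero)) (subst Uniqueᴱ eq u)
    where
    eq : edges L ++ walkSteps G (trail l) ++ walkSteps G (trail l′) ≡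
         edges (L ++ refutation l zero ++ refutation l′ (suc zero))
    eq = sym (trans (map-++ proj₁ L _) (cong (edges L ++_)
      (trans (map-++ proj₁ (refutation l zero) _)
        (cong₂ _++_ (edges-refutation l zero) (edges-refutation l′ (suc zero))))))
  ... | φ , sat = go (φ v) refl
    where
    sat₁ = Satisfies-++ˡ {φ} L sat
    sat₂ = Satisfies-++ˡ {φ} (refutation l zero) (Satisfies-++ʳ {φ} L sat)
    sat₃ = Satisfies-++ʳ {φ} (refutation l zero) (Satisfies-++ʳ {φ} L sat)

    go : ∀ p → φ v ≡ p → ⊥
    go zero       φv = refutes l zero sat₂ (λ Kx → trans (constant sat₁ Kx (start l)) φv)
    go (suc zero) φv = refutes l′ (suc zero) sat₃ (λ Kx → trans (constant sat₁ Kx (start l)) φv)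

  -- Ears

  -- `S` and `F` are the vertices and edges already used. Unlike an ear of an ear decomposition, it
  -- may close on its own shaft. The field `edgesUnique` also prevents the last edge from retracing
  -- the end of the shaft, which `unique` would allow.
  record Ear (S : Pred Vertex 0ℓ) (F : Pred (Vertex × Vertex) 0ℓ) (v : Vertex) : Set where
    field
      lasso       : Lasso S v
      fresh       : ∀ {x} → x ∈ tailVertices (shaft lasso) → ¬ S x
      unique      : Unique (tailVertices (shaft lasso))
      edgesUnique : Uniqueᴱ (walkSteps G (trail lasso))
      avoids      : ∀ {s} → s ∈ᴱ walkSteps G (trail lasso) → ¬ F s

  open Ear

  -- Otherwise all neighbours of `u` lie in `⁅ v ⁆`, which has one element.
  another-neighbour : MinDegreeAtLeast 2 G → ∀ u v → ∃[ y ] (Adj G u y × y ≢ v)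
  another-neighbour deg u v with any? (λ y → T? (adj G u y) ×-dec ¬? (y ≟ v))
  ... | yes found = found
  ... | no ¬found = contradiction (deg u) (<⇒≱ (s≤s degree≤1))
    where
    only-v : ∀ {y} → y Subset.∈ neighbours G u → y Subset.∈ ⁅ v ⁆
    only-v {y} y∈ with y ≟ v
    ... | yes refl = x∈⁅x⁆ v
    ... | no y≢v   = contradiction
      (y , subst T (sym (trans (sym (lookup∘tabulate (adj G u) y)) ([]=⇒lookup y∈))) _ , y≢v) ¬found

    degree≤1 : degree G u ≤ 1
    degree≤1 = ≤-trans (p⊆q⇒∣p∣≤∣q∣ only-v) (≤-reflexive (∣⁅x⁆∣≡1 v))

  Unique⇒length≤n : ∀ {xs : List Vertex} → Unique xs → length xs ≤ n
  Unique⇒length≤n uxs = injective⇒≤ (lookup-injective uxs)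

  module _ (deg : MinDegreeAtLeast 2 G) where

    -- T lists the vertices visited since the start; it only bounds the search.
    explore : ∀ fuel {S : Pred Vertex 0ℓ} {F : Pred (Vertex × Vertex) 0ℓ} {u v} → Decidable S →
              (∀ {s t} → s ≈ᵉ t → F s → F t) → (∀ {x y} → F (x , y) → S x) →
              S v → Adj G v u → ¬ F (v , u) →
              ∀ {T} → Unique T → (∀ {x} → x ∈ T → S x) → n < fuel + length T → Ear S F v
    explore fuel {S} {F} {u} {v} S? resp F⊆S Sv e ¬F {T} uT T⊆S n< with S? u
    ... | yes Su = record
      { lasso       = record { start = Sv ; shaft = ε ; last = e ; closes = inj₁ Su }
      ; fresh       = λ ()
      ; unique      = []
      ; edgesUnique = [] ∷ []
      ; avoids      = λ { (here s≈) Fs → ¬F (resp s≈ Fs) }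
      }
    ... | no ¬Su with fuel
    -- `T` lists distinct vertices, hence at most `n` of them, so the search cannot run out of fuel.
    ...   | zero = contradiction (Unique⇒length≤n uT) (<⇒≱ n<)
    ...   | suc fuel′ with another-neighbour deg u v
    ...     | y , d , y≢v = record
      { lasso       = record
        { start = Sv ; shaft = e ◅ shaft l ; last = last l ; closes = closes′ (closes l) }
      ; fresh       = λ { (here refl) → ¬Su ; (there x∈) → fresh ear x∈ ∘ inj₁ }
      ; unique      = ∉⇒All≉ (setoid _) (λ u∈ → fresh ear u∈ (inj₂ refl)) ∷ unique ear
      ; edgesUnique = ∉⇒All≉ edgeSetoid (λ s∈ → avoids ear s∈ (inj₂ ≈ᵉ-refl)) ∷ edgesUnique ear
      ; avoids      = λ { (here s≈) Fs → ¬F (resp s≈ Fs) ; (there s∈) → avoids ear s∈ ∘ inj₁ }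
      }
      where
      -- The remaining search counts `u` and the edge just traversed as used, so running back into
      -- `u` ends it too; `closes′` then separates a return to `S` from a return to the shaft.
      S′ : Pred Vertex 0ℓ
      S′ x = S x ⊎ x ≡ u

      F′ : Pred (Vertex × Vertex) 0ℓ
      F′ s = F s ⊎ s ≈ᵉ (v , u)

      ear : Ear S′ F′ u
      ear = explore fuel′ (λ x → S? x ⊎-dec (x ≟ u))
        (λ s≈t → Sum.map (resp s≈t) (≈ᵉ-trans (≈ᵉ-sym s≈t)))
        (λ { (inj₁ f)                  → inj₁ (F⊆S f)
           ; (inj₂ (inj₁ (refl , _))) → inj₁ Sv
           ; (inj₂ (inj₂ (refl , _))) → inj₂ refl })
        (inj₂ refl) d
        (λ { (inj₁ f)                  → ¬Su (F⊆S f)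
           ; (inj₂ (inj₁ (u≡v , _))) → Adj-irreflexive e (sym u≡v)
           ; (inj₂ (inj₂ (_ , y≡v))) → y≢v y≡v })
        (∉⇒All≉ (setoid _) (¬Su ∘ T⊆S) ∷ uT)
        (λ { (here refl) → inj₂ refl ; (there x∈) → inj₁ (T⊆S x∈) })
        (≤-trans n< (≤-reflexive (sym (+-suc fuel′ (length T)))))

      l : Lasso S′ u
      l = lasso ear

      closes′ : ∀ {x} → S′ x ⊎ x ∈ tailVertices (shaft l) → S x ⊎ x ∈ u ∷ tailVertices (shaft l)
      closes′ (inj₁ (inj₁ Sx))  = inj₁ Sx
      closes′ (inj₁ (inj₂ x≡u)) = inj₂ (here x≡u)
      closes′ (inj₂ x∈)         = inj₂ (there x∈)

    earAt : ∀ {S : Pred Vertex 0ℓ} {F : Pred (Vertex × Vertex) 0ℓ} {u v} → Decidable S →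
            (∀ {s t} → s ≈ᵉ t → F s → F t) → (∀ {x y} → F (x , y) → S x) →
            S v → Adj G v u → ¬ F (v , u) → Ear S F v
    earAt S? resp F⊆S Sv e ¬F = explore (suc n) S? resp F⊆S Sv e ¬F [] (λ ()) (m≤m+n (suc n) 0)

  simple-back : ∀ {u v x} (p : Walk G u v) {q : Walk G v x} →
                Unique (walkVertices G (p ◅◅ q)) → Unique (walkVertices G q)
  simple-back ε       u       = u
  simple-back (e ◅ p) (_ ∷ u) = simple-back p u

  module _ {S : Pred Vertex 0ℓ} {F : Pred (Vertex × Vertex) 0ℓ} {v} (ear : Ear S F v) where

    private
      l = lasso ear

    shaft-simple : Unique (walkVertices G (shaft l))
    shaft-simple = subst Unique (sym (walkVertices-tail (shaft l)))
      (∉⇒All≉ (setoid _) (λ v∈ → fresh ear v∈ (start l)) ∷ unique ear)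

    -- Together with `trail-internal`, this lets an ear between two distinct vertices of a cycle
    -- serve as the third path of a theta graph.
    trail-simple : S (y l) → v ≢ y l → Unique (walkVertices G (trail l))
    trail-simple Sy v≢y = subst Unique (sym (walkVertices-snoc (shaft l) (last l)))
      (Unique.++⁺ shaft-simple ([] ∷ [])
        (λ { (y∈ , here refl) →
          [ v≢y ∘ sym , (λ y∈′ → fresh ear y∈′ Sy) ]′ (∈⇒∈-tail (shaft l) y∈) }))

    trail-internal : ∀ {x} → x ∈ walkVertices G (trail l) → S x → x ≡ v ⊎ x ≡ y l
    trail-internal x∈ Sx
      with ∈-++⁻ (walkVertices G (shaft l)) (subst (_ ∈_) (walkVertices-snoc (shaft l) (last l)) x∈)
    ... | inj₂ (here x≡y) = inj₂ x≡y
    ... | inj₁ x∈shaft with ∈⇒∈-tail (shaft l) x∈shaft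
    ...   | inj₁ x≡v = inj₁ x≡v
    ...   | inj₂ x∈′ = contradiction Sx (fresh ear x∈′)

  -- Cycles

  -- The base point occurs both first and last, so simplicity is required of the tail only. The
  -- field `loopEdges` excludes going along an edge and straight back.
  record Cycle (a : Vertex) : Set where
    field
      loop       : Walk G a a
      nonempty   : a ∈ tailVertices loop
      loopSimple : Unique (tailVertices loop)
      loopEdges  : Uniqueᴱ (walkSteps G loop)

  open Cycle

  -- An ear on the single vertex `r` closes on its shaft, `r` included. Cutting the shaft there
  -- leaves a loop: the back part followed by the last edge.
  earCycle : ∀ {F r} → Ear (_≡ r) F r → ∃ Cycle
  earCycle {r = r} ear with split (shaft (lasso ear)) (closing∈ (closes (lasso ear)))
    where
    closing∈ : ∀ {x} → x ≡ r ⊎ x ∈ tailVertices (shaft (lasso ear)) →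
               x ∈ walkVertices G (shaft (lasso ear))
    closing∈ (inj₁ refl) = start∈ (shaft (lasso ear))
    closing∈ (inj₂ x∈)   = ∈-tail⇒∈ (shaft (lasso ear)) x∈
  ... | splitting {front} {back} eq = y l , record
    { loop       = back ◅◅ (last l ◅ ε)
    ; nonempty   = subst (_ ∈_) (sym tail≡) (∈-++⁺ʳ (tailVertices back) (here refl))
    ; loopSimple = subst Unique (sym tail≡) (Unique-resp-↭ (↭.++-comm [ y l ] (tailVertices back))
        (subst Unique (walkVertices-tail back)
          (simple-back front (subst (Unique ∘ walkVertices G) eq (shaft-simple ear)))))
    ; loopEdges  = proj₁ (proj₂ (Unique-++⁻ edgeSetoid (walkSteps G front)
        (subst Uniqueᴱ steps≡ (edgesUnique ear))))
    }
    where
    l = lasso ear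

    tail≡ : tailVertices (back ◅◅ (last l ◅ ε)) ≡ tailVertices back ++ [ y l ]
    tail≡ = tailVertices-◅◅ back (last l ◅ ε)

    steps≡ : walkSteps G (trail l) ≡ walkSteps G front ++ walkSteps G (back ◅◅ (last l ◅ ε))
    steps≡ = trans (cong (λ w → walkSteps G (w ◅◅ (last l ◅ ε))) eq)
      (trans (cong (walkSteps G) (◅◅-assoc front back _)) (walkSteps-◅◅ front _))

  -- Moves the base point to the vertex from which an edge leaves the cycle.
  rotate : ∀ {a x} (c : Cycle a) → x ∈ tailVertices (loop c) →
           Σ[ c′ ∈ Cycle x ] walkSteps G (loop c) ↭ walkSteps G (loop c′)
  rotate c x∈ with split-tail (loop c) x∈
  ... | splitting {front} {back} eq , _ = record
    { loop       = back ◅◅ front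
    ; nonempty   = ↭.∈-resp-↭ (↭.map⁺ proj₂ steps↭) x∈
    ; loopSimple = Unique-resp-↭ (↭.map⁺ proj₂ steps↭) (loopSimple c)
    ; loopEdges  = Uniqueᴱ-resp-↭ steps↭ (loopEdges c)
    } , steps↭
    where
    steps↭ : walkSteps G (loop c) ↭ walkSteps G (back ◅◅ front)
    steps↭ = ↭-trans (↭-reflexive (trans (cong (walkSteps G) eq) (walkSteps-◅◅ front back)))
      (↭-trans (↭.++-comm (walkSteps G front) (walkSteps G back))
        (↭-reflexive (sym (walkSteps-◅◅ back front))))

  another-on-loop : ∀ {a} (c : Cycle a) → ∃[ x ] (x ∈ tailVertices (loop c) × a ≢ x)
  another-on-loop c = second (loop c) (nonempty c)
    where
    second : ∀ {a b} (w : Walk G a b) → b ∈ tailVertices w → ∃[ x ] (x ∈ tailVertices w × a ≢ x)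
    second (e ◅ w) _ = _ , here refl , Adj-irreflexive e

  -- Systems of internally disjoint paths

  -- Internal disjointness alone would admit the single edge `ab` as two of the paths;
  -- `edgesDisjoint` excludes this and later yields distinctness.
  record PathSystem (m : ℕ) (a b : Vertex) : Set where
    field
      path          : Fin m → Walk G a b
      pathSimple    : ∀ i → Unique (walkVertices G (path i))
      internal      : ∀ {i j} → i ≢ j → ∀ {x} →
                      x ∈ walkVertices G (path i) → x ∈ walkVertices G (path j) → x ≡ a ⊎ x ≡ b
      edgesDisjoint : ∀ {i j} → i ≢ j → Disjointᴱ (walkSteps G (path i)) (walkSteps G (path j))

    OnVertex : Pred Vertex 0ℓ
    OnVertex x = ∃[ i ] x ∈ walkVertices G (path i)

    OnEdge : Pred (Vertex × Vertex) 0ℓ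
    OnEdge s = ∃[ i ] s ∈ᴱ walkSteps G (path i)

  open PathSystem

  -- The two paths are the part of the loop up to `x` and the reverse of the rest.
  cutCycle : ∀ {a x} (c : Cycle a) → x ∈ tailVertices (loop c) → a ≢ x →
             Σ[ B ∈ PathSystem 2 a x ]
               ((∀ {t} → OnVertex B t ⇔ t ∈ tailVertices (loop c)) ×
                (∀ {s} → OnEdge B s ⇔ s ∈ᴱ walkSteps G (loop c)))
  cutCycle {a} {x} c x∈ a≢x with split-tail (loop c) x∈
  ... | splitting {f} {b} eq , x∈f =
    B , mk⇔ (λ (i , t∈) → subst (_ ∈_) (sym tail≡) (vertices⁻ i t∈)) (vertices⁺ ∘ subst (_ ∈_) tail≡)
      , mk⇔ (λ (i , s∈) → subst (_ ∈ᴱ_) (sym steps≡) (edges⁻ i s∈)) (edges⁺ ∘ subst (_ ∈ᴱ_) steps≡)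
    where
    tail≡ : tailVertices (loop c) ≡ tailVertices f ++ tailVertices b
    tail≡ = trans (cong tailVertices eq) (tailVertices-◅◅ f b)

    steps≡ : walkSteps G (loop c) ≡ walkSteps G f ++ walkSteps G b
    steps≡ = trans (cong (walkSteps G) eq) (walkSteps-◅◅ f b)

    a∈b : a ∈ tailVertices b
    a∈b = end∈-tail (a≢x ∘ sym) b

    vertexParts = Unique-++⁻ (setoid _) (tailVertices f) (subst Unique tail≡ (loopSimple c))
    edgeParts   = Unique-++⁻ edgeSetoid (walkSteps G f) (subst Uniqueᴱ steps≡ (loopEdges c))
    vertexDisjoint = proj₂ (proj₂ vertexParts)
    edgeDisjoint   = proj₂ (proj₂ edgeParts)

    half : Fin 2 → Walk G a x
    half zero       = f
    half (suc zero) = reverseWalk b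

    ∈-reverse⁻ : ∀ {t} → t ∈ walkVertices G (reverseWalk b) → t ≡ x ⊎ t ∈ tailVertices b
    ∈-reverse⁻ t∈ = ∈⇒∈-tail b (↭.∈-resp-↭ (walkVertices-reverse b) t∈)

    ends : ∀ {t} → t ∈ walkVertices G f → t ∈ walkVertices G (reverseWalk b) → t ≡ a ⊎ t ≡ x
    ends t∈f t∈b with ∈⇒∈-tail f t∈f | ∈-reverse⁻ t∈b
    ... | inj₁ t≡a | _        = inj₁ t≡a
    ... | _        | inj₁ t≡x = inj₂ t≡x
    ... | inj₂ p   | inj₂ q   = contradiction (p , q) vertexDisjoint

    B : PathSystem 2 a x
    B = record
      { path          = half
      ; pathSimple    = λ
        { zero       → subst Unique (sym (walkVertices-tail f))
            (∉⇒All≉ (setoid _) (λ a∈f → vertexDisjoint (a∈f , a∈b)) ∷ proj₁ vertexParts)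
        ; (suc zero) → Unique-resp-↭ (↭-sym (walkVertices-reverse b))
            (subst Unique (sym (walkVertices-tail b))
              (∉⇒All≉ (setoid _) (λ x∈b → vertexDisjoint (x∈f , x∈b)) ∷ proj₁ (proj₂ vertexParts)))
        }
      ; internal      = λ
        { {zero}     {zero}     i≢j → contradiction refl i≢j
        ; {zero}     {suc zero} _   → ends
        ; {suc zero} {zero}     _   → λ p q → ends q p
        ; {suc zero} {suc zero} i≢j → contradiction refl i≢j
        }
      ; edgesDisjoint = λ
        { {zero}     {zero}     i≢j → contradiction refl i≢j
        ; {zero}     {suc zero} _   → λ (p , q) → edgeDisjoint (p , ∈ᴱ-reverse⁻ b q)
        ; {suc zero} {zero}     _   → λ (p , q) → edgeDisjoint (q , ∈ᴱ-reverse⁻ b p)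
        ; {suc zero} {suc zero} i≢j → contradiction refl i≢j
        }
      }

    vertices⁻ : ∀ i {t} → t ∈ walkVertices G (half i) → t ∈ tailVertices f ++ tailVertices b
    vertices⁻ zero       t∈ =
      [ (λ { refl → ∈-++⁺ʳ (tailVertices f) a∈b }) , ∈-++⁺ˡ ]′ (∈⇒∈-tail f t∈)
    vertices⁻ (suc zero) t∈ =
      [ (λ { refl → ∈-++⁺ˡ x∈f }) , ∈-++⁺ʳ (tailVertices f) ]′ (∈-reverse⁻ t∈)

    vertices⁺ : ∀ {t} → t ∈ tailVertices f ++ tailVertices b → OnVertex B t
    vertices⁺ t∈ with ∈-++⁻ (tailVertices f) t∈
    ... | inj₁ p = zero , ∈-tail⇒∈ f p
    ... | inj₂ q = suc zero , ↭.∈-resp-↭ (↭-sym (walkVertices-reverse b)) (∈-tail⇒∈ b q)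

    edges⁻ : ∀ i {s} → s ∈ᴱ walkSteps G (half i) → s ∈ᴱ walkSteps G f ++ walkSteps G b
    edges⁻ zero       s∈ = Any.++⁺ˡ s∈
    edges⁻ (suc zero) s∈ = Any.++⁺ʳ (walkSteps G f) (∈ᴱ-reverse⁻ b s∈)

    edges⁺ : ∀ {s} → s ∈ᴱ walkSteps G f ++ walkSteps G b → OnEdge B s
    edges⁺ s∈ with Any.++⁻ (walkSteps G f) s∈
    ... | inj₁ p = zero , p
    ... | inj₂ q = suc zero , ∈ᴱ-reverse⁺ b q

  addPath : ∀ {m a b} (B : PathSystem m a b) (w : Walk G a b) → Unique (walkVertices G w) →
            (∀ {x} → x ∈ walkVertices G w → OnVertex B x → x ≡ a ⊎ x ≡ b) →
            (∀ {s} → s ∈ᴱ walkSteps G w → ¬ OnEdge B s) → PathSystem (suc m) a b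
  addPath B w uw ends avoid = record
    { path          = λ { zero → w ; (suc i) → path B i }
    ; pathSimple    = λ { zero → uw ; (suc i) → pathSimple B i }
    ; internal      = λ
      { {zero}  {zero}  i≢j → contradiction refl i≢j
      ; {zero}  {suc j} _   → λ p q → ends p (j , q)
      ; {suc i} {zero}  _   → λ p q → ends q (i , p)
      ; {suc i} {suc j} i≢j → internal B (i≢j ∘ cong suc)
      }
    ; edgesDisjoint = λ
      { {zero}  {zero}  i≢j → contradiction refl i≢j
      ; {zero}  {suc j} _   → λ (p , q) → avoid p (j , q)
      ; {suc i} {zero}  _   → λ (p , q) → avoid q (i , p)
      ; {suc i} {suc j} i≢j → edgesDisjoint B (i≢j ∘ cong suc)
      }
    }

  -- Shows that walks with equal vertex sequences have equal edges, so edge-disjoint paths between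
  -- distinct ends are distinct.
  walkSteps-vertices : ∀ {u v} (w : Walk G u v) →
                       walkSteps G w ≡ zip (walkVertices G w) (drop 1 (walkVertices G w))
  walkSteps-vertices ε           = refl
  walkSteps-vertices (e ◅ ε)     = refl
  walkSteps-vertices (e ◅ d ◅ w) = cong (_ ∷_) (walkSteps-vertices (d ◅ w))

  -- Necessity: from a cycle to a theta graph

  Closed : Pred Vertex 0ℓ → Pred (Vertex × Vertex) 0ℓ → Set
  Closed S F = ∀ {v u} → S v → Adj G v u → F (v , u)

  exit? : ∀ {S : Pred Vertex 0ℓ} {F : Pred (Vertex × Vertex) 0ℓ} → Decidable S → Decidable F →
          (∃[ v ] ∃[ u ] (S v × Adj G v u × ¬ F (v , u))) ⊎ Closed S F
  exit? S? F? with any? (λ v → any? (λ u → S? v ×-dec T? (adj G v u) ×-dec ¬? (F? (v , u))))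
  ... | yes exit  = inj₁ exit
  ... | no ¬exit = inj₂ λ {v} {u} Sv e →
    decidable-stable (F? (v , u)) (λ ¬F → ¬exit (v , u , Sv , e , ¬F))

  module _ (connected : Connected G) where

    -- Along any walk from `a`, each edge lies on the system because it is closed, hence so does the
    -- next vertex; by connectedness the system is all of `G`. The index `i₀` supplies a path
    -- through `a` to start from.
    consists : ∀ {m a b} → a ≢ b → (B : PathSystem m a b) → Fin m → Closed (OnVertex B) (OnEdge B) →
               ConsistsOfDisjointPaths m G
    consists {m} {a} {b} a≢b B i₀ closed = a , b , a≢b , P , record
      { distinct           = distinct
      ; internallyDisjoint = λ i j i≢j x → internal B i≢j
      ; coversVertices     = everywhere
      ; coversEdges        = λ x y e → let i , s∈ = closed (everywhere x) e in i , ∈ᴱ⇒∈ s∈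
      }
      where
      P : Fin m → Path G a b
      P i = record { walk = path B i ; simple = pathSimple B i }

      distinct : ∀ i j → i ≢ j → vertices (P i) ≢ vertices (P j)
      distinct i j i≢j eq with ∈-map⁻ proj₂ (end∈-tail a≢b (path B i))
      ... | s , s∈ , _ = edgesDisjoint B i≢j (∈⇒∈ᴱ s∈ , ∈⇒∈ᴱ (subst (s ∈_) steps≡ s∈))
        where
        steps≡ : walkSteps G (path B i) ≡ walkSteps G (path B j)
        steps≡ = trans (walkSteps-vertices (path B i))
          (trans (cong (λ l → zip l (drop 1 l)) eq) (sym (walkSteps-vertices (path B j))))

      along : ∀ {u v} → Walk G u v → OnVertex B u → OnVertex B v
      along ε       on = on
      along (e ◅ w) on = along w (let i , s∈ = closed on e in i , proj₂ (edge-ends∈ (path B i) s∈))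

      everywhere : ∀ x → OnVertex B x
      everywhere x = along (walk (proj₂ connected a x)) (i₀ , start∈ (path B i₀))

    module _ (deg : MinDegreeAtLeast 2 G) (scc : SingleConflictColorable 2 G) where

      -- If an edge leaves the theta graph, it extends to an ear. Two of the three paths form a
      -- cycle `K` carrying every attachment of the ear; the ear and the third path are then
      -- edge-disjoint lassos on `K`.
      theta-case : ∀ {a b} → a ≢ b → PathSystem 3 a b → ConsistsOfDisjointPaths 3 G
      theta-case {a} {b} a≢b B
        with exit? {OnVertex B} {OnEdge B} (λ x → any? λ i → x ∈? walkVertices G (path B i))
                   (λ s → any? λ i → s ∈ᴱ? walkSteps G (path B i))
      ... | inj₂ closed = consists a≢b B zero closed
      ... | inj₁ (v , u , (i , v∈) , e , ¬F) = ⊥-elim (refute (closing (closes l)))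
        where
        ear : Ear (OnVertex B) (OnEdge B) v
        ear = earAt deg (λ x → any? λ i → x ∈? walkVertices G (path B i))
          (λ s≈t (i , s∈) → i , ∈ᴱ-resp-≈ s≈t s∈)
          (λ (i , s∈) → i , proj₁ (edge-ends∈ (path B i) s∈)) (i , v∈) e ¬F

        l = lasso ear

        closing : OnVertex B (y l) ⊎ y l ∈ tailVertices (shaft l) →
                  ∃[ j ] (y l ∈ walkVertices G (path B j) ⊎ y l ∈ tailVertices (shaft l))
        closing (inj₁ (j , y∈)) = j , inj₁ y∈
        -- The ear closes on itself, so any index would do for the second attachment.
        closing (inj₂ y∈)       = i , inj₂ y∈

        refute : ∃[ j ] (y l ∈ walkVertices G (path B j) ⊎ y l ∈ tailVertices (shaft l)) → ⊥
        refute (j , y∈) with two-others i j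
        ... | j′ , k , i≢j′ , i≢k , j′≢k , j≡ =
          two-lassos scc core constant (proj₁ third) (reLasso l (inj₁ v∈) (Sum.map₁ (place j≡) y∈))
            (subst Uniqueᴱ (sym core-edges) edgesAllUnique)
          where
          P = path B

          K : Pred Vertex 0ℓ
          K x = x ∈ walkVertices G (P i) ⊎ x ∈ walkVertices G (P j′)

          place : j ≡ i ⊎ j ≡ j′ → ∀ {x} → x ∈ walkVertices G (P j) → K x
          place (inj₁ refl) = inj₁
          place (inj₂ refl) = inj₂

          core : List Clause
          core = chain zero (P i) ++ chain (suc zero) (P j′)

          constant : ∀ {φ} → Satisfies φ core → ∀ {x y} → K x → K y → φ x ≡ φ y
          constant {φ} sat Kx Ky = trans (toStart Kx) (sym (toStart Ky))
            where
            toStart : ∀ {x} → K x → φ x ≡ φ a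
            toStart = chains-constant (P i) (P j′) (Satisfies-++ˡ {φ} (chain zero (P i)) sat)
              (Satisfies-++ʳ {φ} (chain zero (P i)) sat)

          -- Path `k` leaves and re-enters the cycle at `a` and `b`.
          third : Σ[ l′ ∈ Lasso K a ] walkSteps G (trail l′) ≡ walkSteps G (P k)
          third = walkLasso (P k) (end∈-tail a≢b (P k)) (inj₁ (start∈ (P i))) (inj₁ (end∈ (P i)))

          core-edges : edges core ++ walkSteps G (trail (proj₁ third)) ++ walkSteps G (trail l) ≡
                       (walkSteps G (P i) ++ walkSteps G (P j′)) ++
                       walkSteps G (P k) ++ walkSteps G (trail l)
          core-edges = cong₂ _++_
            (trans (map-++ proj₁ (chain zero (P i)) _)
              (cong₂ _++_ (edges-chain _ (P i)) (edges-chain _ (P j′))))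
            (cong (_++ _) (proj₂ third))

          pathEdges : ∀ i → Uniqueᴱ (walkSteps G (P i))
          pathEdges i = simple⇒Uniqueᴱ (P i) (pathSimple B i)

          path-trail : ∀ i → Disjointᴱ (walkSteps G (P i)) (walkSteps G (trail l))
          path-trail i (p , q) = avoids ear q (i , p)

          edgesAllUnique : Uniqueᴱ ((walkSteps G (P i) ++ walkSteps G (P j′)) ++
                                    walkSteps G (P k) ++ walkSteps G (trail l))
          edgesAllUnique = ++ᴱ⁺
            (++ᴱ⁺ (pathEdges i) (pathEdges j′) (edgesDisjoint B i≢j′))
            (++ᴱ⁺ (pathEdges k) (edgesUnique ear) (path-trail k))
            (Disjointᴱ-++
              (Disjointᴱ-sym (Disjointᴱ-++ (edgesDisjoint B (i≢k ∘ sym)) (edgesDisjoint B (j′≢k ∘ sym))))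
              (Disjointᴱ-sym (Disjointᴱ-++ (Disjointᴱ-sym (path-trail i)) (Disjointᴱ-sym (path-trail j′)))))

      ear-case : ∀ {v u} (c : Cycle v) → Adj G v u → ¬ ((v , u) ∈ᴱ walkSteps G (loop c)) →
                 ConsistsOfDisjointPaths 3 G
      ear-case {v} c e ¬F = go (closes l)
        where
        F⊆S : ∀ {x y} → (x , y) ∈ᴱ walkSteps G (loop c) → x ∈ tailVertices (loop c)
        F⊆S s∈ = [ (λ { refl → nonempty c }) , id ]′ (∈⇒∈-tail (loop c) (proj₁ (edge-ends∈ (loop c) s∈)))

        ear : Ear (_∈ tailVertices (loop c)) (_∈ᴱ walkSteps G (loop c)) v
        ear = earAt deg (_∈? tailVertices (loop c)) ∈ᴱ-resp-≈ F⊆S (nonempty c) e ¬F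

        l = lasso ear

        -- Here the base set is the single vertex `v`, on which constancy costs no clauses; the
        -- cycle and the ear are the two lassos.
        refute : y l ≡ v ⊎ y l ∈ tailVertices (shaft l) → ⊥
        refute closes′ with walkLasso {K = _≡ v} (loop c) (nonempty c) refl refl
        ... | l′ , eq = two-lassos scc [] (λ _ → λ { refl refl → refl }) l′ (reLasso l refl closes′)
          (subst (λ es → Uniqueᴱ (es ++ _)) (sym eq)
            (++ᴱ⁺ (loopEdges c) (edgesUnique ear) (λ (p , q) → avoids ear q p)))

        go : y l ∈ tailVertices (loop c) ⊎ y l ∈ tailVertices (shaft l) → ConsistsOfDisjointPaths 3 G
        go (inj₂ y∈) = ⊥-elim (refute (inj₂ y∈))
        go (inj₁ y∈) with v ≟ y l
        ... | yes v≡y = ⊥-elim (refute (inj₁ (sym v≡y)))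
        ... | no v≢y with cutCycle c y∈ v≢y
        ...   | B , vs , es = theta-case v≢y (addPath B (trail l) (trail-simple ear y∈ v≢y)
          (λ x∈ → trail-internal ear x∈ ∘ Equivalence.to vs)
          (λ s∈ → avoids ear s∈ ∘ Equivalence.to es))

      cycle-case : ∀ {a} → Cycle a → ConsistsOfDisjointPaths 2 G ⊎ ConsistsOfDisjointPaths 3 G
      cycle-case c with exit? (_∈? tailVertices (loop c)) (_∈ᴱ? walkSteps G (loop c))
      ... | inj₁ (v , u , v∈ , e , ¬F) with rotate c v∈
      ...   | c′ , steps↭ = inj₂ (ear-case c′ e (¬F ∘ ↭.Any-resp-↭ (↭-sym steps↭)))
      -- No edge leaves the cycle, so `G` is the cycle, and any second vertex cuts it into two
      -- paths.
      cycle-case c | inj₂ closed with another-on-loop c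
      ...   | x , x∈ , a≢x with cutCycle c x∈ a≢x
      ...     | B , vs , es =
        inj₁ (consists a≢x B zero (λ on e → Equivalence.from es (closed (Equivalence.to vs on) e)))

      colorable⇒paths : ConsistsOfDisjointPaths 2 G ⊎ ConsistsOfDisjointPaths 3 G
      colorable⇒paths with proj₁ connected
      -- Any edge at `r` will do; excluding `r` itself is no restriction, as there are no loops. The
      -- ear starts with nothing used except the vertex `r`.
      ... | r with another-neighbour deg r r
      ...   | u , e , _ = cycle-case (proj₂ (earCycle
        (earAt deg {F = λ _ → ⊥} (_≟ r) (λ _ ()) (λ ()) refl e (λ ()))))

  -- Colouring along paths

  module _ (c : LocalPartition 2 G) where

    Respects : (Vertex → Fin 2) → ∀ {u v} → Walk G u v → Set
    Respects φ w = ∀ {x y} → (x , y) ∈ walkSteps G w → (e : Adj G x y) →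
      ¬ (φ x ≡ c x (y , e) × φ y ≡ c y (x , Adj-sym G e))

    -- As `u` is not on `w`, recolouring it leaves `w` undisturbed, and only the edge `e` remains to
    -- be checked.
    prepend : ∀ {u x v} (e : Adj G u x) (w : Walk G x v) → All (u ≢_) (walkVertices G w) →
              ∀ ψ α → Respects ψ w → ¬ (α ≡ c u (x , e) × ψ x ≡ c x (u , Adj-sym G e)) →
              ∃[ φ ] (φ u ≡ α × (∀ {t} → t ∈ walkVertices G w → φ t ≡ ψ t) × Respects φ (e ◅ w))
    prepend {u} {x} e w u∉ ψ α good ok = φ , φ-u , φ-w , respects
      where
      φ : Vertex → Fin 2
      φ t with t ≟ u
      ... | yes _ = α
      ... | no _  = ψ t

      φ-u : φ u ≡ α
      φ-u with u ≟ u
      ... | yes _  = refl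
      ... | no u≢u = contradiction refl u≢u

      φ-w : ∀ {t} → t ∈ walkVertices G w → φ t ≡ ψ t
      φ-w {t} t∈ with t ≟ u
      ... | yes t≡u = contradiction (sym t≡u) (All.lookup u∉ t∈)
      ... | no _    = refl

      respects : Respects φ (e ◅ w)
      respects (here refl) e′ (p , q) with T-irrelevant e′ e
      ... | refl = ok (trans (sym φ-u) p , trans (sym (φ-w (start∈ w))) q)
      respects (there s∈) e′ (p , q) = good s∈ e′
        ( trans (sym (φ-w (step-source∈ w s∈))) p
        , trans (sym (φ-w (∈-tail⇒∈ w (step-target∈ w s∈)))) q )

    -- Induction on the walk. The forbidden pair consists of the colour that the first edge has at
    -- `u` and the colour that the last edge has at `v`.
    one-forbidden-pair : ∀ {u v} (w : Walk G u v) → Unique (walkVertices G w) → u ≢ v →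
      ∃[ p ] ∃[ q ] (∀ α β → ¬ (α ≡ p × β ≡ q) → ∃[ φ ] (φ u ≡ α × φ v ≡ β × Respects φ w))
    one-forbidden-pair ε _ u≢u = contradiction refl u≢u
    one-forbidden-pair {u} {v} (e ◅ ε) (u∉ ∷ _) _ = c u (v , e) , c v (u , Adj-sym G e) , λ α β ok →
      let φ , φ-u , φ-v , good = prepend e ε u∉ (λ _ → β) α (λ ()) ok
      in φ , φ-u , φ-v (here refl) , good
    one-forbidden-pair {u} {v} (_◅_ {j = x} e w@(_ ◅ w′)) (u∉ ∷ uw@(x∉ ∷ _)) _
      with one-forbidden-pair w uw (All.lookup x∉ (end∈ w′))
    ... | p , q , colour = c u (x , e) , q , extend
      where
      through : ∀ α β γ → ¬ (γ ≡ p × β ≡ q) → ¬ (α ≡ c u (x , e) × γ ≡ c x (u , Adj-sym G e)) →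
                ∃[ φ ] (φ u ≡ α × φ v ≡ β × Respects φ (e ◅ w))
      through α β γ ok ok′ with colour γ β ok
      ... | ψ , ψ-x , ψ-v , good
        with prepend e w u∉ ψ α good (λ (α≡ , ψ≡) → ok′ (α≡ , trans (sym ψ-x) ψ≡))
      ...   | φ , φ-u , φ-w , good′ = φ , φ-u , trans (φ-w (end∈ w)) ψ-v , good′

      extend : ∀ α β → ¬ (α ≡ c u (x , e) × β ≡ q) →
               ∃[ φ ] (φ u ≡ α × φ v ≡ β × Respects φ (e ◅ w))
      extend α β ok with α ≟ c u (x , e)
      -- The first edge is already safe, so the next vertex may take the colour that the rest of the
      -- walk accepts for every `β`.
      ... | no α≢  = through α β (opposite p) (opposite-≢ p ∘ proj₁) (α≢ ∘ proj₁)
      -- Now `β` differs from `q`, so the rest accepts any colour of the next vertex; the one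
      -- avoiding a conflict on `e` is taken.
      ... | yes α≡ = through α β (opposite (c x (u , Adj-sym G e)))
        (λ (_ , β≡) → ok (α≡ , β≡)) (opposite-≢ _ ∘ proj₂)

  -- The four pairs of end colours are encoded in `Fin 4` by `combine`. Each path forbids at most
  -- one of them, so a pair `k` is left, and the colourings it gives agree at `a` and `b` and can be
  -- glued.
  paths⇒colorable : ∀ {m} → m < 4 → ConsistsOfDisjointPaths m G → SingleConflictColorable 2 G
  paths⇒colorable {m} m<4 (a , b , a≢b , P , union) c
    with missed-value m<4 (λ i → let p , q , _ = forbidden i in combine p q)
    where
    forbidden = λ i → one-forbidden-pair c (walk (P i)) (simple (P i)) a≢b
  ... | k , missed = φ , conflictFree
    where
    open IsUnionOfDisjointPaths union

    forbidden = λ i → one-forbidden-pair c (walk (P i)) (simple (P i)) a≢b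

    α β : Fin 2
    α = proj₁ (remQuot {2} 2 k)
    β = proj₂ (remQuot {2} 2 k)

    colouring : ∀ i → ∃[ ψ ] (ψ a ≡ α × ψ b ≡ β × Respects c ψ (walk (P i)))
    colouring i = let _ , _ , colour = forbidden i in
      colour α β λ (α≡ , β≡) → missed i
        (trans (sym (cong₂ combine α≡ β≡)) (combine-remQuot {2} 2 k))

    φ : Vertex → Fin 2
    φ x with x ≟ a | x ≟ b
    ... | yes _ | _     = α
    ... | no _  | yes _ = β
    ... | no _  | no _  = proj₁ (colouring (proj₁ (coversVertices x))) x

    -- A vertex other than `a` and `b` lies on only one path, so the path picked by `coversVertices`
    -- must be `P i`.
    φ-on : ∀ i {x} → x ∈ᵛ P i → φ x ≡ proj₁ (colouring i) x
    φ-on i {x} x∈ with x ≟ a | x ≟ b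
    ... | yes refl | _        = sym (proj₁ (proj₂ (colouring i)))
    ... | no _     | yes refl = sym (proj₁ (proj₂ (proj₂ (colouring i))))
    ... | no x≢a   | no x≢b with proj₁ (coversVertices x) ≟ i
    ...   | yes refl = refl
    ...   | no j≢i   = ⊥-elim ([ x≢a , x≢b ]′
      (internallyDisjoint _ i j≢i x (proj₂ (coversVertices x)) x∈))

    onPath : ∀ i {x y} → (x , y) ∈ steps (P i) → (e : Adj G x y) →
             ¬ (φ x ≡ c x (y , e) × φ y ≡ c y (x , Adj-sym G e))
    onPath i s∈ e (p , q) = proj₂ (proj₂ (proj₂ (colouring i))) s∈ e
      ( trans (sym (φ-on i (step-source∈ (walk (P i)) s∈))) p
      , trans (sym (φ-on i (∈-tail⇒∈ (walk (P i)) (step-target∈ (walk (P i)) s∈)))) q )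

    conflictFree : ∀ x y (e : Adj G x y) → ¬ (φ x ≡ c x (y , e) × φ y ≡ c y (x , Adj-sym G e))
    conflictFree x y e (p , q) with coversEdges x y e
    ... | i , inj₁ s∈ = onPath i s∈ e (p , q)
    -- The path runs through the edge from `y` to `x`. Reversing the adjacency proof twice gives
    -- back `e`, because such proofs are unique.
    ... | i , inj₂ s∈ = onPath i s∈ (Adj-sym G e)
      (q , trans p (cong (λ d → c x (y , d)) (T-irrelevant e (Adj-sym G (Adj-sym G e)))))

proposition2p3 : ∀ {n : ℕ} (G : Graph n) → Connected G → MinDegreeAtLeast 2 G →
    SingleConflictColorable 2 G ⇔ (ConsistsOfDisjointPaths 2 G ⊎ ConsistsOfDisjointPaths 3 G)
proposition2p3 G connected deg = mk⇔
  (colorable⇒paths G connected deg)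
  [ paths⇒colorable G (s≤s (s≤s (s≤s z≤n))) , paths⇒colorable G (s≤s (s≤s (s≤s (s≤s z≤n)))) ]′
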